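{- Let $\mathcal G$ be a temporal graph, let $(\star)$ be one of the optimality criteria shortest, shortest-foremost, prefix-foremost, and suppose that the $(\star)$-temporal vertex diameter satisfies $VD^{(\star)}\ge 3$. Then the VC-dimension of the range space $\mathcal R=(\mathcal D,\mathcal F^+)$ defined in the context satisfies $$VC(\mathcal R)\le\lfloor\log_2(VD^{(\star)}-2)\rfloor+1 .$$
   Context: A (directed) temporal graph is $\mathcal G=(V,\mathcal E)$ with $V$ finite and $\mathcal E$ a finite set of temporal edges $(u,v,t)$, $u,v\in V$, $t\in T=\{1,\dots,|T|\}$. A temporal path from $s$ to $z\ne s$ is a sequence of vertex appearances $((u_1,t_1),\dots,(u_k,t_k))$ with $u_1=s$, $u_k=z$, $t_1=0$, $t_i<t_{i+1}$ and $(u_i,u_{i+1},t_{i+1})\in\mathcal E$. Its length is its number $k-1$ of temporal edges, its arrival time is $t_k$, and $\mathbf{Int}(tp)$ is the set of its appearances other than the first and the last. It is foremost if no temporal path from $s$ to $z$ arrives earlier (the trivial path from $s$ to itself arrives at time $0$). $(\star)$-optimal means: shortest (minimum length), shortest-foremost (minimum length among foremost paths), or prefix-foremost (foremost with every prefix foremost). Let $\mathcal U=\mathbb{TP}^{(\star)}_{\mathcal G}$ be the set of all $(\star)$-optimal temporal paths between all ordered pairs of distinct nodes. The $(\star)$-temporal diameter $D^{(\star)}$ is the maximum length of a path in $\mathcal U$, and the $(\star)$-temporal vertex diameter is $VD^{(\star)}=D^{(\star)}+1$. Range space: $\mathcal D=\mathcal U\times[0,1]$. For $(v,t)\in V\times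 T$ let $f_{(v,t)}:\mathcal U\to\{0,1\}$, $f_{(v,t)}(tp)=1$ if $(v,t)\in\mathbf{Int}(tp)$ and $0$ otherwise, and $R_{f_{(v,t)}}=\{(tp,\alpha)\in\mathcal D:\alpha\le f_{(v,t)}(tp)\}$. Then $\mathcal F^+=\{R_{f_{(v,t)}}:(v,t)\in V\times T\}$. The VC-dimension of $\mathcal R=(\mathcal D,\mathcal F^+)$ is the maximum size of a finite $S\subseteq\mathcal D$ that is shattered, i.e. with $\{S\cap R:R\in\mathcal F^+\}=2^S$. -}

module Defs where

open import Data.Bool.Base using (if_then_else_)
open import Data.Empty using (⊥)
open import Data.Fin.Base using (Fin)
import Data.Fin.Properties as Fin
open import Data.Fin.Subset using (Subset; _∈_)
open import Data.List.Base using (List; length)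
import Data.List.Membership.DecPropositional as DecMembership
import Data.List.Membership.Propositional as Membership
open import Data.List.NonEmpty.Base as List⁺ using (List⁺; _∷_)
open import Data.List.Relation.Binary.Prefix.Heterogeneous using (Prefix)
open import Data.List.Relation.Unary.Linked using (Linked)
open import Data.Nat.Base using (ℕ; suc; _≤_; _<_)
import Data.Nat.Properties as ℕ
open import Data.Product.Base using (∃; _×_; _,_; proj₁; proj₂)
open import Data.Product.Properties using (≡-dec)
open import Data.Product.Relation.Binary.Pointwise.NonDependent using (×-setoid)
open import Data.Rational.Base as ℚ using (ℚ; 0ℚ; 1ℚ)
import Data.Rational.Properties as ℚ
open import Data.Sum.Base using (_⊎_; inj₁; inj₂)
open import Function.Base using (id)
open import Function.Bundles using (_⇔_)
open import Function.Definitions using (Injective)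
open import Level using (Level; 0ℓ; _⊔_) renaming (suc to lsuc)
open import Relation.Binary.Bundles using (Setoid)
import Relation.Binary.Construct.On as On
open import Relation.Binary.Definitions using (DecidableEquality; tri<; tri≈; tri>)
open import Relation.Binary.PropositionalEquality.Core using (_≡_; _≢_; refl)
open import Relation.Binary.PropositionalEquality.Properties using (setoid)
open import Relation.Nullary.Decidable.Core using (Dec; does; _×-dec_; ¬?)
open import Relation.Unary using (Pred)

private variable
  a ℓ i r : Level

IsMaximum : Pred ℕ ℓ → ℕ → Set ℓ
IsMaximum P m = P m × (∀ n → P n → n ≤ m)

------------------------------------------------------------------------
-- Real numbers, as two-sided Dedekind cuts

record ℝ : Set₁ where
  field
    lower upper     : ℚ → Set
    lower-inhabited : ∃ lower
    upper-inhabited : ∃ upper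
    lower-closed    : ∀ {p q} → p ℚ.< q → lower q → lower p
    upper-closed    : ∀ {p q} → p ℚ.< q → upper p → upper q
    lower-open      : ∀ {p} → lower p → ∃ λ q → p ℚ.< q × lower q
    upper-open      : ∀ {q} → upper q → ∃ λ p → p ℚ.< q × upper p
    disjoint        : ∀ {q} → lower q → upper q → ⊥
    located         : ∀ {p q} → p ℚ.< q → lower p ⊎ upper q

infix 4 _≤ℝ_ _≈ℝ_

_≤ℝ_ : ℝ → ℝ → Set
x ≤ℝ y = ∀ {q} → ℝ.lower x q → ℝ.lower y q

_≈ℝ_ : ℝ → ℝ → Set
x ≈ℝ y = (x ≤ℝ y) × (y ≤ℝ x)

ℝ-setoid : Setoid (lsuc 0ℓ) 0ℓ
ℝ-setoid = record
  { Carrier       = ℝ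
  ; _≈_           = _≈ℝ_
  ; isEquivalence = record
    { refl  = id , id
    ; sym   = λ (x≤y , y≤x) → y≤x , x≤y
    ; trans = λ (x≤y , y≤x) (y≤z , z≤y) → (λ l → y≤z (x≤y l)) , (λ l → y≤x (z≤y l))
    }
  }

fromℚ : ℚ → ℝ
fromℚ x = record
  { lower           = ℚ._< x
  ; upper           = x ℚ.<_
  ; lower-inhabited = x ℚ.- 1ℚ , below
  ; upper-inhabited = x ℚ.+ 1ℚ , above
  ; lower-closed    = ℚ.<-trans
  ; upper-closed    = λ p<q x<p → ℚ.<-trans x<p p<q
  ; lower-open      = λ p<x → let m , p<m , m<x = ℚ.<-dense p<x in m , p<m , m<x
  ; upper-open      = λ x<q → let m , x<m , m<q = ℚ.<-dense x<q in m , m<q , x<m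
  ; disjoint        = ℚ.<-asym
  ; located         = located
  }
  where
  below : x ℚ.- 1ℚ ℚ.< x
  below = begin-strict
    x ℚ.- 1ℚ  <⟨ ℚ.+-monoʳ-< x (ℚ.negative⁻¹ (ℚ.- 1ℚ)) ⟩
    x ℚ.+ 0ℚ  ≡⟨ ℚ.+-identityʳ x ⟩
    x         ∎
    where open ℚ.≤-Reasoning

  above : x ℚ.< x ℚ.+ 1ℚ
  above = begin-strict
    x         ≡⟨ ℚ.+-identityʳ x ⟨
    x ℚ.+ 0ℚ  <⟨ ℚ.+-monoʳ-< x (ℚ.positive⁻¹ 1ℚ) ⟩
    x ℚ.+ 1ℚ  ∎
    where open ℚ.≤-Reasoning

  located : ∀ {p q} → p ℚ.< q → p ℚ.< x ⊎ x ℚ.< q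
  located {p} p<q with ℚ.<-cmp p x
  ... | tri< p<x _ _    = inj₁ p<x
  ... | tri≈ _ refl _   = inj₂ p<q
  ... | tri> _ _ x<p    = inj₂ (ℚ.<-trans x<p p<q)

0ℝ 1ℝ : ℝ
0ℝ = fromℚ 0ℚ
1ℝ = fromℚ 1ℚ

record UnitInterval : Set₁ where
  field
    value : ℝ
    0≤    : 0ℝ ≤ℝ value
    ≤1    : value ≤ℝ 1ℝ

UnitInterval-setoid : Setoid (lsuc 0ℓ) 0ℓ
UnitInterval-setoid = On.setoid ℝ-setoid UnitInterval.value

------------------------------------------------------------------------
-- Range spaces

-- The ranges form an indexed family; different indices may yield the same
-- range, which does not affect which sets are shattered.
record RangeSpace (a ℓ i r : Level) : Set (lsuc (a ⊔ ℓ ⊔ i ⊔ r)) where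
  field
    points : Setoid a ℓ
    Index  : Set i
    range  : Index → Pred (Setoid.Carrier points) r

module _ (X : RangeSpace a ℓ i r) where
  open RangeSpace X
  open Setoid points using (Carrier; _≈_)

  -- A set of n points is given by an injective enumeration S, and its subsets
  -- by the subsets A of Fin n.  Only 2^S ⊆ {S ∩ R} is required, the other
  -- inclusion being automatic.
  Shattered : ∀ {n} → (Fin n → Carrier) → Set (i ⊔ r)
  Shattered {n} S = ∀ (A : Subset n) → ∃ λ R → ∀ k → k ∈ A ⇔ range R (S k)

  ShattersSetOfSize : ℕ → Set (a ⊔ ℓ ⊔ i ⊔ r)
  ShattersSetOfSize n = ∃ λ (S : Fin n → Carrier) → Injective _≡_ _≈_ S × Shattered S

  IsVCDimension : ℕ → Set (a ⊔ ℓ ⊔ i ⊔ r)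
  IsVCDimension = IsMaximum ShattersSetOfSize

------------------------------------------------------------------------
-- Temporal graphs

record TemporalGraph : Set where
  field
    order    : ℕ
    lifetime : ℕ

  Vertex : Set
  Vertex = Fin order

  IsTime : ℕ → Set
  IsTime t = 1 ≤ t × t ≤ lifetime

  open Membership using () renaming (_∈_ to _∈ₗ_)

  field
    edges      : List (Vertex × Vertex × ℕ)
    edge-times : ∀ {u v t} → (u , v , t) ∈ₗ edges → IsTime t

data Criterion : Set where
  shortest shortest-foremost prefix-foremost : Criterion

module _ (G : TemporalGraph) where
  open TemporalGraph G
  open Membership using () renaming (_∈_ to _∈ₗ_)

  Appearance : Set
  Appearance = Vertex × ℕ

  _≟ₐ_ : DecidableEquality Appearance
  _≟ₐ_ = ≡-dec Fin._≟_ ℕ._≟_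

  Step : Appearance → Appearance → Set
  Step (u , t) (v , t′) = t < t′ × (u , v , t′) ∈ₗ edges

  Appearances : Set
  Appearances = List⁺ Appearance

  target : Appearances → Vertex
  target p = proj₁ (List⁺.last p)

  arrival : Appearances → ℕ
  arrival p = proj₂ (List⁺.last p)

  -- The number of temporal edges, one less than the number of appearances.
  pathLength : Appearances → ℕ
  pathLength (_ ∷ as) = length as

  -- The case s ≡ z is allowed, so that the trivial path (s , 0) ∷ [] competes
  -- in the definition of foremost paths from s to itself.
  record IsTemporalPath (s z : Vertex) (p : Appearances) : Set where
    field
      starts : List⁺.head p ≡ (s , 0)
      ends   : target p ≡ z
      steps  : Linked Step (List⁺.toList p)

  IsShortest : Vertex → Vertex → Pred Appearances 0ℓ
  IsShortest s z p =
    IsTemporalPath s z p × (∀ q → IsTemporalPath s z q → pathLength p ≤ pathLength q)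

  IsForemost : Vertex → Vertex → Pred Appearances 0ℓ
  IsForemost s z p =
    IsTemporalPath s z p × (∀ q → IsTemporalPath s z q → arrival p ≤ arrival q)

  IsShortestForemost : Vertex → Vertex → Pred Appearances 0ℓ
  IsShortestForemost s z p =
    IsForemost s z p × (∀ q → IsForemost s z q → pathLength p ≤ pathLength q)

  IsPrefixForemost : Vertex → Vertex → Pred Appearances 0ℓ
  IsPrefixForemost s z p =
    IsForemost s z p ×
    (∀ q → Prefix _≡_ (List⁺.toList q) (List⁺.toList p) → IsForemost s (target q) q)

  IsOptimal : Criterion → Vertex → Vertex → Pred Appearances 0ℓ
  IsOptimal shortest          = IsShortest
  IsOptimal shortest-foremost = IsShortestForemost
  IsOptimal prefix-foremost   = IsPrefixForemost

  record OptimalPath (⋆ : Criterion) : Set where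
    field
      {source sink} : Vertex
      path          : Appearances
      distinct      : source ≢ sink
      optimal       : IsOptimal ⋆ source sink path

  OptimalPath-setoid : Criterion → Setoid 0ℓ 0ℓ
  OptimalPath-setoid ⋆ = On.setoid (setoid Appearances) (OptimalPath.path {⋆})

  IsTemporalDiameter : Criterion → ℕ → Set
  IsTemporalDiameter ⋆ =
    IsMaximum λ n → ∃ λ (tp : OptimalPath ⋆) → pathLength (OptimalPath.path tp) ≡ n

  IsTemporalVertexDiameter : Criterion → ℕ → Set
  IsTemporalVertexDiameter ⋆ VD = ∃ λ D → IsTemporalDiameter ⋆ D × VD ≡ suc D

  -- Times strictly increase along a path, so no inner appearance equals the
  -- first or the last one.
  _∈Int_ : Appearance → Appearances → Set
  x ∈Int p = x ∈ₗ List⁺.toList p × x ≢ List⁺.head p × x ≢ List⁺.last p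

  _∈Int?_ : ∀ x p → Dec (x ∈Int p)
  x ∈Int? p =
    (x ∈ₗ? List⁺.toList p) ×-dec ¬? (x ≟ₐ List⁺.head p) ×-dec ¬? (x ≟ₐ List⁺.last p)
    where open DecMembership _≟ₐ_ using () renaming (_∈?_ to _∈ₗ?_)

  indicator : ∀ {⋆} → Appearance → OptimalPath ⋆ → ℝ
  indicator x tp = if does (x ∈Int? OptimalPath.path tp) then 1ℝ else 0ℝ

  rangeSpace : Criterion → RangeSpace (lsuc 0ℓ) 0ℓ 0ℓ 0ℓ
  rangeSpace ⋆ = record
    { points = ×-setoid (OptimalPath-setoid ⋆) UnitInterval-setoid
    ; Index  = Vertex × ∃ IsTime
    ; range  = λ (v , t , _) (tp , α) → UnitInterval.value α ≤ℝ indicator (v , t) tp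
    }

{-# OPTIONS --safe #-}

-- Shattering the empty subset forces every second coordinate α above 0, so that
-- (tp , α) lies in the range of x exactly when x ∈Int tp: the second coordinates
-- are irrelevant, and shattering only concerns the sets Int tp.  If n + 1 optimal
-- paths are shattered, the 2 ^ n subsets containing the first one are cut out by
-- distinct inner appearances of that path, which has at most VD − 2 of them.  The
-- maximum exists constructively because temporal paths are words of bounded length
-- over the finite set of edge ends, hence shattering is decidable.
module Submission where

open import Defs
open import Data.Bool.Base using (if_then_else_)
open import Data.Fin.Base using (Fin; zero; suc; combine; remQuot)
import Data.Fin.Properties as Fin
open import Data.Fin.Subset using (Subset; inside; _∈_; _⊆_; ⁅_⁆) renaming (⊥ to ∅)
open import Data.Fin.Subset.Properties
  using (_∈?_; anySubset?; ∉⊥; x∈⁅x⁆; x∈⁅y⁆⇒x≡y; ⊆-antisym)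
open import Data.List.Base as List
  using (List; []; _∷_; _++_; length; allFin; upTo; cartesianProduct; cartesianProductWith)
import Data.List.Membership.DecPropositional as DecMembership
open import Data.List.Membership.Propositional using (lose) renaming (_∈_ to _∈ₗ_)
open import Data.List.Membership.Propositional.Properties
  using (∈-map⁺; ∈-++⁻; ∈-allFin; ∈-upTo⁺; ∈-cartesianProduct⁺; ∈-cartesianProductWith⁺)
import Data.List.Membership.Setoid.Properties as SetoidMembership
open import Data.List.NonEmpty.Base as List⁺ using (_∷_; _∷ʳ′_)
open import Data.List.Properties using (length-++)
open import Data.List.Relation.Binary.Prefix.Heterogeneous using (Prefix; []; _∷_)
import Data.List.Relation.Unary.All as Allₗ
open import Data.List.Relation.Unary.Any as Any using (here; there)
open import Data.List.Relation.Unary.Linked using (Linked; _∷_; linked?)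
open import Data.Nat.Base using (ℕ; zero; suc; _+_; _∸_; _^_; _≤_; z≤n; s≤s)
open import Data.Nat.Logarithm using (⌊log₂_⌋; ⌊log₂⌋-mono-≤; ⌊log₂[2^n]⌋≡n)
import Data.Nat.Properties as ℕ
open import Data.Product.Base using (∃; _×_; _,_; proj₁; proj₂)
open import Data.Product.Properties using (≡-dec)
open import Data.Rational.Base using (1ℚ)
import Data.Rational.Properties as ℚ
open import Data.Sum.Base using (inj₁; inj₂)
open import Data.Vec.Base as Vec using (Vec; []; _∷_)
open import Data.Vec.Properties using (∷-injective; lookup∘tabulate)
open import Data.Vec.Relation.Unary.All as All using (All; []; _∷_)
import Data.Vec.Relation.Unary.All.Properties as All
open import Function.Base using (_∘_; id)
open import Function.Bundles using (_⇔_; mk⇔; Inverse; Injection; module Equivalence)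
open import Function.Construct.Composition using (_⇔-∘_)
open import Function.Construct.Symmetry using (⇔-sym)
open import Function.Definitions using (Injective)
open import Function.Properties.Inverse using (Inverse⇒Injection)
open import Level using (Level)
open import Relation.Binary.Definitions using (DecidableEquality)
open import Relation.Binary.PropositionalEquality
  using (_≡_; _≢_; refl; sym; trans; cong; cong₂; subst; setoid)
open import Relation.Nullary.Decidable
  using (Dec; does; yes; no; map′; ¬?; _×-dec_; _→-dec_; decidable-stable)
open import Relation.Nullary.Negation using (¬_; contradiction)
open import Relation.Unary using (Pred; Decidable)

open Equivalence using (to; from)

private variable
  a p q : Level
  A : Set a

-- Decision procedures for quantifiers over finite domains.

_⇔-dec_ : {P : Set p} {Q : Set q} → Dec P → Dec Q → Dec (P ⇔ Q)
P? ⇔-dec Q? =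
  map′ (λ (f , g) → mk⇔ f g) (λ e → to e , from e) ((P? →-dec Q?) ×-dec (Q? →-dec P?))

module _ {P : Pred A p} (P? : Decidable P) (xs : List A) (P⊆xs : ∀ {x} → P x → x ∈ₗ xs) where

  listed-∃? : Dec (∃ P)
  listed-∃? = map′ Any.satisfied (λ (_ , px) → lose (P⊆xs px) px) (Any.any? P? xs)

  listed-∀? : {Q : Pred A q} → Decidable Q → Dec (∀ x → P x → Q x)
  listed-∀? Q? = map′
    (λ all x px → Allₗ.lookup all (P⊆xs px) px)
    (λ f → Allₗ.universal f xs)
    (Allₗ.all? (λ x → P? x →-dec Q? x) xs)

allSubset? : ∀ {n} {P : Pred (Subset n) p} → Decidable P → Dec (∀ S → P S)
allSubset? P? = map′
  (λ ∄ S → decidable-stable (P? S) λ ¬PS → ∄ (S , ¬PS))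
  (λ ∀P (S , ¬PS) → ¬PS (∀P S))
  (¬? (anySubset? (¬? ∘ P?)))

allPrefix? : {P : Pred (List A) p} → Decidable P → ∀ xs → Dec (∀ ys → Prefix _≡_ ys xs → P ys)
allPrefix? P? []       = map′ (λ { p _ [] → p }) (λ f → f [] []) (P? [])
allPrefix? P? (x ∷ xs) = map′
  (λ { (p , f) _ [] → p ; (p , f) (_ ∷ ys) (refl ∷ pre) → f ys pre })
  (λ f → f [] [] , λ ys pre → f (x ∷ ys) (refl ∷ pre))
  (P? [] ×-dec allPrefix? (P? ∘ (x ∷_)) xs)

-- Finite enumerations and bounded search.

tuples : List A → ∀ n → List (Vec A n)
tuples xs zero    = [] ∷ []
tuples xs (suc n) = cartesianProductWith _∷_ xs (tuples xs n)

∈-tuples : ∀ {xs : List A} {n} {v : Vec A n} → All (_∈ₗ xs) v → v ∈ₗ tuples xs n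
∈-tuples []         = here refl
∈-tuples (px ∷ pxs) = ∈-cartesianProductWith⁺ _∷_ px (∈-tuples pxs)

-- Every length up to `n` occurs, since the steps of a path are bounded in number but not fixed.
words : List A → ℕ → List (List A)
words xs zero    = [] ∷ []
words xs (suc n) = [] ∷ cartesianProductWith _∷_ xs (words xs n)

[]∈words : ∀ {xs : List A} n → [] ∈ₗ words xs n
[]∈words zero    = here refl
[]∈words (suc n) = here refl

-- The search descends from `b` to the first value satisfying `P`; `P 0` ensures that it succeeds.
bounded-maximum : {P : Pred ℕ p} → Decidable P → P 0 → ∀ b → (∀ n → P n → n ≤ b) → ∃ (IsMaximum P)
bounded-maximum P? p0 zero    bound = 0 , p0 , bound
bounded-maximum P? p0 (suc b) bound with P? (suc b)
... | yes pb = suc b , pb , bound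
... | no ¬pb = bounded-maximum P? p0 b λ n pn →
  ℕ.≤-pred (ℕ.≤∧≢⇒< (bound n pn) λ { refl → ¬pb pn })

-- Counting subsets through binary digits.

bits : ∀ n → Fin (2 ^ n) → Subset n
bits zero    i = []
bits (suc n) i = let b , j = remQuot {2} (2 ^ n) i in Inverse.to Fin.2↔Bool b ∷ bits n j

bits-injective : ∀ n → Injective _≡_ _≡_ (bits n)
bits-injective zero    {zero} {zero} _  = refl
bits-injective (suc n) {i}    {j}    eq =
  let b≡ , r≡ = ∷-injective eq in
  trans (sym (Fin.combine-remQuot {2} (2 ^ n) i))
    (trans (cong₂ combine (Injection.injective (Inverse⇒Injection Fin.2↔Bool) b≡) (bits-injective n r≡))
      (Fin.combine-remQuot {2} (2 ^ n) j))

-- Composed with the binary digits, `f` becomes an injection of `Fin (2 ^ n)` into `Fin m`.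
subsets-counted : ∀ {n m} (f : Subset n → Fin m) → Injective _≡_ _≡_ f → 2 ^ n ≤ m
subsets-counted {n} f inj = Fin.injective⇒≤ {f = f ∘ bits n} (bits-injective n ∘ inj)

-- Comparing numbers of the unit interval with an indicator.

0≤1 : 0ℝ ≤ℝ 1ℝ
0≤1 q<0 = ℚ.<-trans q<0 (ℚ.positive⁻¹ 1ℚ)

1≰0 : ¬ (1ℝ ≤ℝ 0ℝ)
1≰0 1≤0 = ℚ.<-irrefl refl (1≤0 (ℚ.positive⁻¹ 1ℚ))

one : UnitInterval
one = record { value = 1ℝ ; 0≤ = λ {q} → 0≤1 {q} ; ≤1 = id }

char : {P : Set p} → Dec P → ℝ
char P? = if does P? then 1ℝ else 0ℝ

0≤char : {P : Set p} (P? : Dec P) → 0ℝ ≤ℝ char P?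
0≤char (yes _) {q} = 0≤1 {q}
0≤char (no _)      = id

-- If `P` holds, the comparison is with 1 and always true; if not, it is with 0 and excluded by
-- hypothesis.
≤char⇔ : {P : Set p} (P? : Dec P) (α : UnitInterval) → ¬ (UnitInterval.value α ≤ℝ 0ℝ) →
  P ⇔ (UnitInterval.value α ≤ℝ char P?)
≤char⇔ (yes x) α _   = mk⇔ (λ _ {q} → UnitInterval.≤1 α {q}) (λ _ → x)
≤char⇔ (no ¬x) α α≰0 =
  mk⇔ (λ x → contradiction x ¬x) (λ α≤0 → contradiction (λ {q} → α≤0 {q}) α≰0)

-- Inner appearances of a path.

module _ (G : TemporalGraph) where
  open TemporalGraph G

  inner : ∀ p → ∃ λ xs → length xs ≡ pathLength G p ∸ 1 × (∀ {x} → _∈Int_ G x p → x ∈ₗ xs)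
  inner p with List⁺.snocView p
  -- In a trivial path the first and last appearances coincide; the truncated `0 ∸ 1` matches the
  -- empty list.
  ... | []       ∷ʳ′ y = [] , refl , λ { (here eq , ≢h , _) → contradiction eq ≢h }
  ... | (h ∷ ys) ∷ʳ′ y = ys , sym length≡ , locate
    where
    length≡ : length (ys ++ y ∷ []) ∸ 1 ≡ length ys
    length≡ = trans (cong (_∸ 1) (length-++ ys)) (ℕ.m+n∸n≡m (length ys) 1)

    locate : ∀ {x} → (x ∈ₗ h ∷ ys ++ y ∷ []) × x ≢ h × x ≢ y → x ∈ₗ ys
    locate (here x≡h , x≢h , _) = contradiction x≡h x≢h
    locate (there x∈ , _ , x≢y) with ∈-++⁻ ys x∈
    ... | inj₁ x∈ys       = x∈ys
    ... | inj₂ (here x≡y) = contradiction x≡y x≢y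

  -- Enumeration of temporal paths.

  edgeEnds : List (Appearance G)
  edgeEnds = List.map (λ (_ , v , t) → v , t) edges

  -- Each step raises the time by at least one and no edge is later than `lifetime`, so at most `n`
  -- steps can follow time `t`. The hypothesis `lifetime ≤ t + n` is the invariant of the induction.
  ∈-words : ∀ {u t} as n → Linked (Step G) ((u , t) ∷ as) → lifetime ≤ t + n → as ∈ₗ words edgeEnds n
  ∈-words []             n       _                    _     = []∈words n
  ∈-words {t = t} ((v , t′) ∷ as) zero ((t<t′ , e) ∷ _) bound =
    contradiction (ℕ.<-≤-trans t<t′ (proj₂ (edge-times e)))
      (ℕ.≤⇒≯ (subst (lifetime ≤_) (ℕ.+-identityʳ t) bound))
  ∈-words {t = t} ((v , t′) ∷ as) (suc n) ((t<t′ , e) ∷ steps) bound = there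
    (∈-cartesianProductWith⁺ _∷_ (∈-map⁺ _ e)
      (∈-words as n steps
        (ℕ.≤-trans (subst (lifetime ≤_) (ℕ.+-suc t n) bound) (ℕ.+-monoˡ-≤ n t<t′))))

  -- A finite superset of the temporal paths: consecutive appearances need not be joined by an edge
  -- here.
  temporalPaths : List (Appearances G)
  temporalPaths = cartesianProductWith _∷_ (List.map (_, 0) (allFin order)) (words edgeEnds lifetime)

  ∈-temporalPaths : ∀ {s z p} → IsTemporalPath G s z p → p ∈ₗ temporalPaths
  ∈-temporalPaths {s} {p = _ ∷ as} record { starts = refl ; steps = steps } =
    ∈-cartesianProductWith⁺ _∷_ (∈-map⁺ (_, 0) (∈-allFin s)) (∈-words as lifetime steps ℕ.≤-refl)

  -- Decidability of the optimality criteria.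

  _≟ₑ_ : DecidableEquality (Vertex × Vertex × ℕ)
  _≟ₑ_ = ≡-dec Fin._≟_ (≡-dec Fin._≟_ ℕ._≟_)

  step? : ∀ x y → Dec (Step G x y)
  step? (u , t) (v , t′) = (t ℕ.<? t′) ×-dec ((u , v , t′) ∈ₗ? edges)
    where open DecMembership _≟ₑ_ using () renaming (_∈?_ to _∈ₗ?_)

  isTemporalPath? : ∀ s z → Decidable (IsTemporalPath G s z)
  isTemporalPath? s z p = map′
    (λ (a , b , c) → record { starts = a ; ends = b ; steps = c })
    (λ tp → let open IsTemporalPath tp in starts , ends , steps)
    (_≟ₐ_ G (List⁺.head p) (s , 0) ×-dec (target G p Fin.≟ z) ×-dec linked? step? (List⁺.toList p))

  isShortest? : ∀ s z → Decidable (IsShortest G s z)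
  isShortest? s z p = isTemporalPath? s z p ×-dec
    listed-∀? (isTemporalPath? s z) temporalPaths ∈-temporalPaths (λ q → pathLength G p ℕ.≤? pathLength G q)

  isForemost? : ∀ s z → Decidable (IsForemost G s z)
  isForemost? s z p = isTemporalPath? s z p ×-dec
    listed-∀? (isTemporalPath? s z) temporalPaths ∈-temporalPaths (λ q → arrival G p ℕ.≤? arrival G q)

  isShortestForemost? : ∀ s z → Decidable (IsShortestForemost G s z)
  isShortestForemost? s z p = isForemost? s z p ×-dec
    listed-∀? (isForemost? s z) temporalPaths (∈-temporalPaths ∘ proj₁)
      (λ q → pathLength G p ℕ.≤? pathLength G q)

  isPrefixForemost? : ∀ s z → Decidable (IsPrefixForemost G s z)
  isPrefixForemost? s z p@(h ∷ as) = isForemost? s z p ×-dec map′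
    -- A nonempty prefix of `h ∷ as` is `h` followed by a prefix of `as`, so only the tails need to
    -- be searched.
    (λ { f (_ ∷ bs) (refl ∷ pre) → f bs pre })
    (λ f bs pre → f (h ∷ bs) (refl ∷ pre))
    (allPrefix? (λ bs → isForemost? s (target G (h ∷ bs)) (h ∷ bs)) as)

  isOptimal? : ∀ ⋆ s z → Decidable (IsOptimal G ⋆ s z)
  isOptimal? shortest          = isShortest?
  isOptimal? shortest-foremost = isShortestForemost?
  isOptimal? prefix-foremost   = isPrefixForemost?

  optimal⇒temporal : ∀ ⋆ {s z p} → IsOptimal G ⋆ s z p → IsTemporalPath G s z p
  optimal⇒temporal shortest          = proj₁
  optimal⇒temporal shortest-foremost = proj₁ ∘ proj₁
  optimal⇒temporal prefix-foremost   = proj₁ ∘ proj₁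

  -- Shattering paths by their inner appearances.

  isTime? : Decidable IsTime
  isTime? t = (1 ℕ.≤? t) ×-dec (t ℕ.≤? lifetime)

  appearances : List (Appearance G)
  appearances = cartesianProduct (allFin order) (upTo (suc lifetime))

  ∈-appearances : ∀ {x} → IsTime (proj₂ x) → x ∈ₗ appearances
  ∈-appearances (_ , t≤) = ∈-cartesianProduct⁺ (∈-allFin _) (∈-upTo⁺ (s≤s t≤))

  nonempty-path⇒time : ∀ {s z p} → IsTemporalPath G s z p → 1 ≤ pathLength G p → ∃ IsTime
  nonempty-path⇒time {p = _ ∷ _ ∷ _} record { steps = (_ , e) ∷ _ } _ = _ , edge-times e

  Separates : ∀ {n} → Vec (Appearances G) n → Subset n → Appearance G → Set
  Separates ps A x = IsTime (proj₂ x) × (∀ k → k ∈ A ⇔ _∈Int_ G x (Vec.lookup ps k))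

  -- Shattering with the real coordinates removed; only finite data remain, which makes it
  -- decidable.
  ShatteredPaths : ∀ {n} → Vec (Appearances G) n → Set
  ShatteredPaths ps = ∀ A → ∃ (Separates ps A)

  shatteredPaths? : ∀ {n} → Decidable (ShatteredPaths {n})
  shatteredPaths? ps = allSubset? λ A → listed-∃?
    (λ x → isTime? (proj₂ x) ×-dec Fin.all? λ k → (k ∈? A) ⇔-dec _∈Int?_ G x (Vec.lookup ps k))
    appearances (∈-appearances ∘ proj₁)

  shatteredPaths-bound : ∀ {n} {p} {ps : Vec _ n} → ShatteredPaths (p ∷ ps) → 2 ^ n ≤ pathLength G p ∸ 1
  shatteredPaths-bound {n} {p} {ps} sh =
    subst (2 ^ n ≤_) length≡ (subsets-counted (Any.index ∘ in-inner) index-injective)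
    where
    int     = proj₁ (inner p)
    length≡ = proj₁ (proj₂ (inner p))

    -- Adding `inside` puts `p` itself into every chosen subset, so all these separators are inner
    -- appearances of `p`.
    separator : Subset n → Appearance G
    separator A = proj₁ (sh (inside ∷ A))

    separates : ∀ A k → k ∈ inside ∷ A ⇔ _∈Int_ G (separator A) (Vec.lookup (p ∷ ps) k)
    separates A = proj₂ (proj₂ (sh (inside ∷ A)))

    in-inner : ∀ A → separator A ∈ₗ int
    in-inner A = proj₂ (proj₂ (inner p)) (to (separates A zero) Vec.here)

    -- An appearance determines the set of paths it is inner to, so equal separators cut out equal
    -- subsets.
    ⊆-separator : ∀ {A B} → separator A ≡ separator B → inside ∷ A ⊆ inside ∷ B
    ⊆-separator {A} {B} eq {k} k∈A =
      from (separates B k) (subst (λ x → _∈Int_ G x _) eq (to (separates A k) k∈A))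

    index-injective : Injective _≡_ _≡_ (Any.index ∘ in-inner)
    index-injective {A} {B} eq = proj₂ (∷-injective
      (⊆-antisym (⊆-separator {A} {B} sep≡) (⊆-separator {B} {A} (sym sep≡))))
      where sep≡ = SetoidMembership.index-injective (setoid _) (in-inner A) (in-inner B) eq

  -- Reducing the range space to sets of optimal paths.

  module _ (⋆ : Criterion) where

    IsOptimalPath : Pred (Appearances G) _
    IsOptimalPath p = ∃ λ s → ∃ λ z → s ≢ z × IsOptimal G ⋆ s z p

    isOptimalPath? : Decidable IsOptimalPath
    isOptimalPath? p = Fin.any? λ s → Fin.any? λ z → ¬? (s Fin.≟ z) ×-dec isOptimal? ⋆ s z p

    toOptimalPath : ∀ {p} → IsOptimalPath p → OptimalPath G ⋆
    toOptimalPath (_ , _ , s≢z , opt) = record { distinct = s≢z ; optimal = opt }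

    fromOptimalPath : (tp : OptimalPath G ⋆) → IsOptimalPath (OptimalPath.path tp)
    fromOptimalPath tp = let open OptimalPath tp in _ , _ , distinct , optimal

    ShattersOptimalPaths : ℕ → Set
    ShattersOptimalPaths n = ∃ λ (ps : Vec (Appearances G) n) → All IsOptimalPath ps × ShatteredPaths ps

    shattersOptimalPaths? : Decidable ShattersOptimalPaths
    shattersOptimalPaths? n = listed-∃?
      (λ ps → All.all? isOptimalPath? ps ×-dec shatteredPaths? ps)
      (tuples temporalPaths n)
      (λ (opt , _) → ∈-tuples (All.map (λ (_ , _ , _ , o) → ∈-temporalPaths (optimal⇒temporal ⋆ o)) opt))

    0≤indicator : ∀ x (tp : OptimalPath G ⋆) → 0ℝ ≤ℝ indicator G x tp
    0≤indicator x tp {q} = 0≤char (_∈Int?_ G x (OptimalPath.path tp)) {q}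

    range⇔∈Int : ∀ x (tp : OptimalPath G ⋆) (α : UnitInterval) → ¬ (UnitInterval.value α ≤ℝ 0ℝ) →
      _∈Int_ G x (OptimalPath.path tp) ⇔ (UnitInterval.value α ≤ℝ indicator G x tp)
    range⇔∈Int x tp α α≰0 = ≤char⇔ (_∈Int?_ G x (OptimalPath.path tp)) α α≰0

    shatters⇒shattersPaths : ∀ {n} → ShattersSetOfSize (rangeSpace G ⋆) n → ShattersOptimalPaths n
    shatters⇒shattersPaths {n} (S , _ , sh) =
      Vec.tabulate path , All.tabulate⁺ (fromOptimalPath ∘ proj₁ ∘ S) , λ A →
        let (v , t , time) , sep = sh A in
        (v , t) , time , λ k →
          subst (λ p → k ∈ A ⇔ _∈Int_ G (v , t) p) (sym (lookup∘tabulate path k))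
            (⇔-sym (range⇔∈Int (v , t) (proj₁ (S k)) (proj₂ (S k)) (α≰0 k)) ⇔-∘ sep k)
      where
      path : Fin n → Appearances G
      path = OptimalPath.path ∘ proj₁ ∘ S

      -- The range cutting out the empty set misses every point, whereas a point with `α ≤ 0` would
      -- lie in it because indicators are nonnegative.
      α≰0 : ∀ k → ¬ (UnitInterval.value (proj₂ (S k)) ≤ℝ 0ℝ)
      α≰0 k α≤0 = let (v , t , _) , sep = sh ∅ in
        ∉⊥ (from (sep k) λ {q} q<α → 0≤indicator (v , t) (proj₁ (S k)) {q} (α≤0 q<α))

    shattersPaths⇒shatters : ∀ {n} → ShattersOptimalPaths n → ShattersSetOfSize (rangeSpace G ⋆) n
    shattersPaths⇒shatters {n} (ps , opt , sh) = S , injective , λ A →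
      let (v , t) , time , sep = sh A in
      (v , t , time) , λ k →
        range⇔∈Int (v , t) (proj₁ (S k)) one (λ 1≤0 → 1≰0 1≤0) ⇔-∘ sep k
      where
      S : Fin n → OptimalPath G ⋆ × UnitInterval
      S k = toOptimalPath (All.lookup⁺ opt k) , one

      -- The appearance separating `⁅ j ⁆` is inner to path `j`; if path `k` is the same, then `k`
      -- belongs to `⁅ j ⁆`.
      injective : ∀ {j k} → (Vec.lookup ps j ≡ Vec.lookup ps k) × (1ℝ ≈ℝ 1ℝ) → j ≡ k
      injective {j} {k} (eq , _) = let _ , _ , sep = sh ⁅ j ⁆ in
        sym (x∈⁅y⁆⇒x≡y j (from (sep k) (subst (_∈Int_ G _) eq (to (sep j) (x∈⁅x⁆ j)))))

    shatters? : Decidable (ShattersSetOfSize (rangeSpace G ⋆))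
    shatters? n = map′ shattersPaths⇒shatters shatters⇒shattersPaths (shattersOptimalPaths? n)

    shattersPaths-bound : ∀ {D} → IsTemporalDiameter G ⋆ D →
      ∀ n → ShattersOptimalPaths n → n ≤ ⌊log₂ (D ∸ 1) ⌋ + 1
    shattersPaths-bound _ zero _ = z≤n
    shattersPaths-bound {D} (_ , longest) (suc n) (p ∷ ps , opt ∷ _ , sh) = begin
      suc n                     ≡⟨ ℕ.+-comm 1 n ⟩
      n + 1                     ≡⟨ cong (_+ 1) (⌊log₂[2^n]⌋≡n n) ⟨
      ⌊log₂ (2 ^ n) ⌋ + 1       ≤⟨ ℕ.+-monoˡ-≤ 1 (⌊log₂⌋-mono-≤ 2^n≤D∸1) ⟩
      ⌊log₂ (D ∸ 1) ⌋ + 1       ∎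
      where
      open ℕ.≤-Reasoning
      -- The first path has length at most `D`, hence at most `D ∸ 1` inner appearances.
      2^n≤D∸1 = ℕ.≤-trans (shatteredPaths-bound sh)
        (ℕ.∸-monoˡ-≤ 1 (longest (pathLength G p) (toOptimalPath opt , refl)))

    -- The empty set has one subset, which still has to be cut out by some range; a vertex and a
    -- time supply it.
    shatters-∅ : Vertex → ∃ IsTime → ShattersSetOfSize (rangeSpace G ⋆) 0
    shatters-∅ v (t , time) = shattersPaths⇒shatters
      ([] , [] , λ _ → (v , t) , time , λ ())

lemma2 : (G : TemporalGraph) (⋆ : Criterion) (VD : ℕ) → IsTemporalVertexDiameter G ⋆ VD → 3 ≤ VD →
    ∃ λ d → IsVCDimension (rangeSpace G ⋆) d × d ≤ ⌊log₂ (VD ∸ 2) ⌋ + 1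
lemma2 G ⋆ _ (D , diam@((tp , refl) , _) , refl) (s≤s 2≤D) =
  -- With `VD` equal to `suc D`, `VD ∸ 2` computes to `D ∸ 1`. The same bound starts the search for
  -- the maximum and limits its result.
  let d , isMax = bounded-maximum (shatters? G ⋆) (shatters-∅ G ⋆ source time) _ bound
  in d , isMax , bound d (proj₁ isMax)
  where
  open OptimalPath tp using (source; optimal)

  -- The path attaining the diameter has at least two edges, and the first of them provides a valid
  -- time.
  time : ∃ (TemporalGraph.IsTime G)
  time = nonempty-path⇒time G (optimal⇒temporal G ⋆ optimal) (ℕ.<⇒≤ 2≤D)

  bound : ∀ n → ShattersSetOfSize (rangeSpace G ⋆) n → n ≤ ⌊log₂ (D ∸ 1) ⌋ + 1
  bound n = shattersPaths-bound G ⋆ diam n ∘ shatters⇒shattersPaths G ⋆
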